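{- Let $(\mathcal{R},\oplus,\leqslant)$ be a lattice ordered monoid with neutral element $0$ whose lattice is conditionally complete, let $D=(V,A)$ be a finite digraph with $o,d\in V$, let $(x_a)_{a\in A}\in\mathcal{R}^A$, let $c:\mathcal{R}\to\mathbb{R}$ and $\rho:\mathcal{R}\to\{0,1\}$ be isotone, and for each $v\in V$ let $b_v\in\mathcal{R}$ satisfy $b_v\leqslant x_P$ for every $v$-$d$ path $P$. Suppose that every cycle $C$ in $D$ satisfies $x_C\geqslant 0$. Then the label correcting algorithm (run with the bounds $b_v$) terminates after a finite number of iterations, and at the end, if $c_{od}^{UB}$ is finite, then $c_{od}^{UB}$ is the cost of a non-dominated optimal solution of the Monoid Resource Constrained Shortest Path Problem; otherwise, the problem admits no feasible solution.
   Context: A lattice ordered monoid $(\mathcal{R},\oplus,\leqslant)$ is a monoid $(\mathcal{R},\oplus)$ (associative, with neutral element $0$, possibly non-commutative) with a partial order $\leqslant$ that is a lattice order and is such that all translations $y\mapsto x\oplus y$ and $y\mapsto y\oplus x$ are isotone (order-preserving). Conditionally complete: every nonempty bounded subset has a meet and a join. Paths are finite sequences of arcs, the head of each being the tail of the next; vertices and arcs may be repeated, and empty paths (one at each vertex, with resource $0$) are allowed. A cycle is a nonempty path whose origin equals its destination. The resource of a path $P=(a_1,\dots,a_k)$ is $x_P=x_{a_1}\oplus\cdots\oplus x_{a_k}$. $P$ is feasible if $\rho(x_P)=0$; its cost is $c(x_P)$. The Monoid Resource Constrained Shortest Path Problem asks for a feasible $o$-$d$ path of minimum cost; an optimal solution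 is such a path. An $o$-$v$ path $P$ dominates an $o$-$v$ path $\tilde P$ if $x_P\leqslant x_{\tilde P}$. An optimal solution $P$ is called non-dominated if there is no $o$-$d$ path $Q$ with $x_Q<x_P$. Label correcting algorithm: maintain a list $L$ of paths with origin $o$, a value $c_{od}^{UB}\in\mathbb{R}\cup\{+\infty\}$, and for each vertex $v$ a list $M_v$ of $o$-$v$ paths. Initially $L$ contains only the empty path at $o$, $c_{od}^{UB}=+\infty$, and all $M_v$ are empty. While $L$ is nonempty, repeat: (1) extract (remove) from $L$ a path $P$, with destination denoted $v$, of minimum key $c(x_P\oplus b_v)$ among the paths of $L$ (ties broken arbitrarily); (2) if $v=d$, $\rho(x_P)=0$ and $c(x_P)<c_{od}^{UB}$, then set $c_{od}^{UB}:=c(x_P)$; (3) else, if both the lower bound test "$\rho(x_P\oplus b_v)=0$ and $c(x_P\oplus b_v)\leq c_{od}^{UB}$" and the dominance test "no path in $M_v$ dominates $P$" hold, then remove from $M_v$ and $L$ all the paths of $M_v$ dominated by $P$, add $P$ to $M_v$, and extend $P$: for each arc $a$ outgoing from $v$, add $P+a$ ($P$ followed by $a$) to $L$. -}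

module Defs where

open import Axiom.ExcludedMiddle using (ExcludedMiddle)
open import Algebra.Core using (Op₂)
open import Algebra.Structures using (IsMonoid)
open import Data.Fin.Base using (Fin; zero)
open import Data.Fin.Properties using (_≟_)
open import Data.List.Base using (List; []; _∷_; _++_; [_]; allFin; filter; mapMaybe)
open import Data.List.Membership.Propositional using (_∈_)
open import Data.List.Relation.Unary.Any using (_─_)
open import Data.Maybe.Base using (Maybe; just; nothing)
open import Data.Nat.Base using (ℕ)
open import Data.Product.Base using (∃; ∃-syntax; _×_; _,_)
open import Data.Rational.Base as ℚ using (ℚ)
open import Data.Sum.Base using (_⊎_)
open import Function.Base using (flip)
open import Function.Bundles using (_⇔_)
open import Induction.WellFounded using (Acc)
open import Level using (Level; _⊔_; suc; 0ℓ)
open import Relation.Binary.Core using (Rel)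
open import Relation.Binary.Definitions using (LeftMonotonic; RightMonotonic)
open import Relation.Binary.Construct.Closure.ReflexiveTransitive using (Star; ε; _◅_; _◅◅_)
import Relation.Binary.Construct.Add.Supremum.NonStrict as NonStrict⁺
import Relation.Binary.Construct.Add.Supremum.Strict as Strict⁺
import Relation.Binary.Construct.NonStrictToStrict as ToStrict
open import Relation.Binary.Lattice.Structures using (IsLattice)
open import Relation.Binary.PropositionalEquality.Core using (_≡_; _≢_; refl)
open import Relation.Nullary.Construct.Add.Supremum using (_⁺; ⊤⁺) renaming ([_] to fin)
open import Relation.Nullary.Decidable.Core using (yes; no)
open import Relation.Nullary.Negation.Core using (¬_)
open import Relation.Unary using (Pred; Satisfiable; _⊆_)

-- Two-sided Dedekind cuts of ℚ.
record ℝ : Set₁ where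
  field
    lower upper   : Pred ℚ 0ℓ
    lower-inhab   : Satisfiable lower
    upper-inhab   : Satisfiable upper
    lower-rounded : ∀ q → lower q ⇔ (∃[ r ] q ℚ.< r × lower r)
    upper-rounded : ∀ q → upper q ⇔ (∃[ r ] r ℚ.< q × upper r)
    disjoint      : ∀ q → ¬ (lower q × upper q)
    located       : ∀ q r → q ℚ.< r → lower q ⊎ upper r

infix 4 _≤ℝ_ _<ℝ_ _≈ℝ_

_≤ℝ_ : Rel ℝ 0ℓ
x ≤ℝ y = ℝ.lower x ⊆ ℝ.lower y

_<ℝ_ : Rel ℝ 0ℓ
x <ℝ y = ∃[ q ] ℝ.upper x q × ℝ.lower y q

_≈ℝ_ : Rel ℝ 0ℓ
x ≈ℝ y = x ≤ℝ y × y ≤ℝ x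

-- ℝ ∪ {+∞}, with +∞ = ⊤⁺ and the finite values fin γ.

open NonStrict⁺ _≤ℝ_ public using () renaming (_≤⁺_ to _≤∞_)
open Strict⁺ _<ℝ_ public using () renaming (_<⁺_ to _<∞_)

record LatticeOrderedMonoid (a ℓ₁ ℓ₂ : Level) : Set (suc (a ⊔ ℓ₁ ⊔ ℓ₂)) where
  infix  4 _≈_ _≤_
  infixr 6 _∨_
  infixr 7 _∧_ _⊕_
  field
    Carrier   : Set a
    _≈_       : Rel Carrier ℓ₁
    _≤_       : Rel Carrier ℓ₂
    _∨_ _∧_   : Op₂ Carrier
    _⊕_       : Op₂ Carrier
    0#        : Carrier
    isLattice : IsLattice _≈_ _≤_ _∨_ _∧_
    isMonoid  : IsMonoid _≈_ _⊕_ 0#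
    ⊕-monoʳ-≤ : LeftMonotonic _≤_ _≤_ _⊕_
    ⊕-monoˡ-≤ : RightMonotonic _≤_ _≤_ _⊕_

  open ToStrict _≈_ _≤_ public using (_<_)

  module _ {p : Level} (S : Pred Carrier p) where

    IsLowerBound IsUpperBound IsMeet IsJoin : Pred Carrier (a ⊔ ℓ₂ ⊔ p)
    IsLowerBound l = ∀ {s} → S s → l ≤ s
    IsUpperBound u = ∀ {s} → S s → s ≤ u
    IsMeet m = IsLowerBound m × (∀ {l} → IsLowerBound l → l ≤ m)
    IsJoin j = IsUpperBound j × (∀ {u} → IsUpperBound u → j ≤ u)

  ConditionallyComplete : (p : Level) → Set (a ⊔ ℓ₂ ⊔ suc p)
  ConditionallyComplete p = (S : Pred Carrier p) → Satisfiable S →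
    ∃ (IsLowerBound S) → ∃ (IsUpperBound S) → ∃ (IsMeet S) × ∃ (IsJoin S)

-- Finite, with loops and parallel arcs allowed.
record Digraph : Set where
  field
    #vertices #arcs : ℕ

  Vertex = Fin #vertices
  Arc    = Fin #arcs

  field
    tail head : Arc → Vertex

  ArcBetween : Rel Vertex 0ℓ
  ArcBetween u v = ∃[ a ] tail a ≡ u × head a ≡ v

  Path : Rel Vertex 0ℓ
  Path = Star ArcBetween

  PathFrom : Pred Vertex 0ℓ
  PathFrom u = ∃[ v ] Path u v

  IsCycle : ∀ {v} → Pred (Path v v) 0ℓ
  IsCycle C = C ≢ ε

  extendBy : ∀ {u v} → Path u v → Arc → Maybe (PathFrom u)
  extendBy {v = v} P a with tail a ≟ v
  ... | yes tail≡v = just (head a , P ◅◅ ((a , tail≡v , refl) ◅ ε))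
  ... | no  _      = nothing

  extensions : ∀ {u v} → Path u v → List (PathFrom u)
  extensions P = mapMaybe (extendBy P) (allFin #arcs)

module Resource {a ℓ₁ ℓ₂ : Level} (𝓡 : LatticeOrderedMonoid a ℓ₁ ℓ₂)
  (D : Digraph) (x : Digraph.Arc D → LatticeOrderedMonoid.Carrier 𝓡) where

  open LatticeOrderedMonoid 𝓡
  open Digraph D

  resource : ∀ {u v} → Path u v → Carrier
  resource ε             = 0#
  resource ((a , _) ◅ P) = x a ⊕ resource P

  Dominates : ∀ {u v} → Rel (Path u v) ℓ₂
  Dominates P Q = resource P ≤ resource Q

  module Problem (o d : Vertex) (c : Carrier → ℝ) (ρ : Carrier → Fin 2) where

    cost : ∀ {u v} → Path u v → ℝ
    cost P = c (resource P)

    Feasible : ∀ {u v} → Pred (Path u v) 0ℓ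
    Feasible P = ρ (resource P) ≡ zero

    Optimal : Pred (Path o d) 0ℓ
    Optimal P = Feasible P × ((Q : Path o d) → Feasible Q → cost P ≤ℝ cost Q)

    NonDominated : Pred (Path o d) (ℓ₁ ⊔ ℓ₂)
    NonDominated P = ¬ (∃ λ (Q : Path o d) → resource Q < resource P)

    record State : Set₁ where
      constructor state
      field
        L    : List (PathFrom o)
        c-UB : ℝ ⁺
        M    : ∀ v → List (Path o v)

    open State public

    initial : State
    initial = state [ o , ε ] ⊤⁺ (λ _ → [])

    _[_≔_] : (∀ v → List (Path o v)) → ∀ v → List (Path o v) →
             ∀ w → List (Path o w)
    (M [ v ≔ Ps ]) w with v ≟ w
    ... | yes refl = Ps
    ... | no  _    = M w

    -- Choosing sublists by undecidable conditions takes excluded middle.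

    module LabelCorrecting (em : ∀ {ℓ} → ExcludedMiddle ℓ)
      (b : Vertex → Carrier) where

      key : PathFrom o → ℝ
      key (v , P) = c (resource P ⊕ b v)

      Improves : State → Pred (PathFrom o) (suc 0ℓ)
      Improves s (v , P) = v ≡ d × Feasible P × fin (cost P) <∞ c-UB s

      PassesLowerBoundTest : State → Pred (PathFrom o) (suc 0ℓ)
      PassesLowerBoundTest s (v , P) =
        ρ (resource P ⊕ b v) ≡ zero × fin (key (v , P)) ≤∞ c-UB s

      PassesDominanceTest : State → Pred (PathFrom o) ℓ₂
      PassesDominanceTest s (v , P) = ¬ (∃[ Q ] Q ∈ M s v × Dominates Q P)

      PassesTests : State → Pred (PathFrom o) (suc 0ℓ ⊔ ℓ₂)
      PassesTests s P = PassesLowerBoundTest s P × PassesDominanceTest s P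

      DominatedInM : ∀ {v} → State → Path o v → Pred (PathFrom o) ℓ₂
      DominatedInM {v} s P Q = ∃[ R ] Q ≡ (v , R) × R ∈ M s v × Dominates P R

      -- The effect of one iteration in state s on the extracted path, where
      -- L′ is the rest of the list.

      data Process (s : State) :
        PathFrom o → List (PathFrom o) → State → Set (suc 0ℓ ⊔ ℓ₂) where

        update : ∀ {v} {P : Path o v} {L′} → Improves s (v , P) →
          Process s (v , P) L′ (state L′ (fin (cost P)) (M s))

        extend : ∀ {v} {P : Path o v} {L′} →
          ¬ Improves s (v , P) → PassesTests s (v , P) →
          Process s (v , P) L′
            (state (filter (λ Q → em {P = ¬ DominatedInM s P Q}) L′ ++ extensions P)
                   (c-UB s)
                   (M s [ v ≔ P ∷ filter (λ R → em {P = ¬ Dominates P R}) (M s v) ]))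

        discard : ∀ {P L′} → ¬ Improves s P → ¬ PassesTests s P →
          Process s P L′ (state L′ (c-UB s) (M s))

      -- The extracted path may be any path of minimum key, hence a relation.

      data Iteration (s s′ : State) : Set (suc 0ℓ ⊔ ℓ₂) where
        iterate : ∀ {P} (P∈L : P ∈ L s) →
          (∀ {Q} → Q ∈ L s → key P ≤ℝ key Q) →
          Process s P (L s ─ P∈L) s′ → Iteration s s′

      Reachable : Pred State (suc 0ℓ ⊔ ℓ₂)
      Reachable = Star Iteration initial

      -- Every run is finite, whatever the tie-breaking, and no run gets stuck
      -- before L is empty.

      Terminates : Set (suc 0ℓ ⊔ ℓ₂)
      Terminates = Acc (flip Iteration) initial ×
        (∀ {s} → Reachable s → L s ≢ [] → ∃ (Iteration s))

{-# OPTIONS --safe #-}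
module Submission where

-- Removing a cycle from a path does not increase its resource, so every path is
-- dominated by one with at most #vertices arcs. A path that is extended is
-- acyclic, because it passes the dominance test while all its strict prefixes
-- are already dominated by the sets M_v. Hence each extension strictly decreases
-- the number of short paths not dominated by the sets M_v, and every other
-- iteration shortens L: this gives termination.
--
-- For optimality, every feasible o-d path Q always satisfies c-UB ≤ c(x_Q) or is
-- covered by some P in L with a completion T such that x_P ⊕ x_T ≤ x_Q. A path P
-- discarded in favour of R in M_v leaves Q covered by R followed by T, which in
-- turn was covered, when R was extended, with a completion shorter than T; the
-- length of the completion makes this argument well founded. An optimal path of
-- cost c-UB is finally replaced by a minimal short path below it.

open import Defs
open import Algebra.Structures using (IsMonoid)
open import Axiom.ExcludedMiddle using (ExcludedMiddle)
open import Data.Fin.Base as Fin using (Fin; zero; suc) renaming (_≤_ to _≤₀₁_)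
open import Data.Fin.Properties as Fin using (pigeonhole)
open import Data.List.Base using (List; []; _∷_; _++_; [_]; length; allFin; filter; map; concatMap)
open import Data.List.Extrema using (argmin; argmin-sel; f[argmin]≤f[⊤]; f[argmin]≤f[xs])
open import Data.List.Membership.Propositional using (_∈_; lose)
open import Data.List.Membership.Propositional.Properties
  using (∈-allFin; ∈-concatMap⁺; ∈-filter⁺; ∈-filter⁻; ∈-map⁺; ∈-++⁺ˡ; ∈-++⁺ʳ; ∈-++⁻)
open import Data.List.Properties using (filter-idem; filter-notAll; length-removeAt′)
open import Data.List.Relation.Binary.Sublist.Propositional using (⊆-refl)
open import Data.List.Relation.Binary.Sublist.Propositional.Properties using (filter⁺; length-mono-≤)
import Data.List.Relation.Unary.All as All
import Data.List.Relation.Unary.All.Properties as All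
open import Data.List.Relation.Unary.Any as Any using (here; there; _─_)
import Data.List.Relation.Unary.Any.Properties as Any
import Data.Maybe.Relation.Unary.All as Maybe
import Data.Maybe.Relation.Unary.Any as Maybe
open import Data.Nat.Base as ℕ using (ℕ; zero; suc; s≤s)
open import Data.Nat.Induction using (<-wellFounded)
import Data.Nat.Properties as ℕ
open import Data.Product.Base using (∃; ∃-syntax; _×_; _,_; proj₁; proj₂)
open import Data.Product.Relation.Binary.Lex.Strict using (×-Lex; ×-wellFounded)
import Data.Rational.Base as ℚ
import Data.Rational.Properties as ℚ
open import Data.Sum.Base using (_⊎_; inj₁; inj₂; [_,_]′)
import Data.Unit.Polymorphic.Base as Unit
open import Function.Base using (_∘_; id; flip)
open import Function.Bundles using (Equivalence)
open import Induction.WellFounded using (Acc; acc; WellFounded)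
open import Level using (Level; _⊔_; 0ℓ)
open import Relation.Binary.Bundles using (TotalOrder)
import Relation.Binary.Construct.Add.Supremum.NonStrict as NonStrict⁺
import Relation.Binary.Construct.Add.Supremum.Strict as Strict⁺
open import Relation.Binary.Construct.Closure.ReflexiveTransitive using (Star; ε; _◅_; _◅◅_)
open import Relation.Binary.Construct.Closure.ReflexiveTransitive.Properties using (◅◅-assoc)
import Relation.Binary.Construct.NonStrictToStrict as ToStrict
open import Relation.Binary.Core using (Rel)
open import Relation.Binary.Definitions using (Monotonic₁)
open import Relation.Binary.Lattice.Structures using (IsLattice)
open import Relation.Binary.PropositionalEquality.Core using (_≡_; _≢_; refl; sym; cong; subst)
open import Relation.Nullary.Construct.Add.Supremum using (_⁺; ⊤⁺) renaming ([_] to fin)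
open import Relation.Nullary.Decidable.Core using (yes; no)
open import Relation.Nullary.Negation.Core using (¬_; contradiction)
open import Relation.Unary using (Pred; _⊆_)

private variable
  ℓ ℓ′ : Level
  A : Set ℓ

-- Order on the Dedekind reals.

module _ where
  open ℝ

  lower-closed : ∀ x {p q} → p ℚ.≤ q → lower x q → lower x p
  lower-closed x {p} p≤q q∈x with r , q<r , r∈x ← Equivalence.to (lower-rounded x _) q∈x =
    Equivalence.from (lower-rounded x p) (r , ℚ.≤-<-trans p≤q q<r , r∈x)

  <ℝ⇒≤ℝ : ∀ {x y} → x <ℝ y → x ≤ℝ y
  <ℝ⇒≤ℝ {x} {y} (q , x<q , q<y) {p} p<x with ℚ.≤-total p q
  ... | inj₁ p≤q = lower-closed y p≤q q<y
  ... | inj₂ q≤p = contradiction (lower-closed x q≤p p<x , x<q) (disjoint x q)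

  -- Roundedness of `y` leaves room above `q` for some `r`, and locatedness of `x` at `q < r` either
  -- puts `q` below `x` or makes `r` separate `x` from `y`.
  ≮ℝ⇒≥ℝ : ∀ {x y} → ¬ x <ℝ y → y ≤ℝ x
  ≮ℝ⇒≥ℝ {x} {y} x≮y {q} q<y with r , q<r , r<y ← Equivalence.to (lower-rounded y q) q<y
    with located x q r q<r
  ... | inj₁ q<x = q<x
  ... | inj₂ x<r = contradiction (r , x<r , r<y) x≮y

-- Lists with one entry removed.

∈-─⁻ : {x y : A} {xs : List A} (x∈xs : x ∈ xs) → y ∈ (xs ─ x∈xs) → y ∈ xs
∈-─⁻ x∈xs = All.lookup (All.─⁺ x∈xs (All.tabulate id))

∈-─⁺ : {x y : A} {xs : List A} (x∈xs : x ∈ xs) → y ∈ xs → x ≡ y ⊎ y ∈ (xs ─ x∈xs)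
∈-─⁺ x∈xs = All.lookup (All.─⁻ x∈xs (inj₁ (Any.lookup-result x∈xs)) (All.tabulate inj₂))

length-─ : {x : A} {xs : List A} (x∈xs : x ∈ xs) → length (xs ─ x∈xs) ℕ.< length xs
length-─ {xs = xs} x∈xs = ℕ.≤-reflexive (sym (length-removeAt′ xs (Any.index x∈xs)))

-- Paths: extension, enumeration, cycles and prefixes.

module Paths (D : Digraph) where
  open Digraph D

  private variable
    u v w : Vertex

  len : Path u v → ℕ
  len ε       = 0
  len (_ ◅ P) = suc (len P)

  len-◅◅ : (P : Path u v) (Q : Path v w) → len (P ◅◅ Q) ≡ len P ℕ.+ len Q
  len-◅◅ ε       Q = refl
  len-◅◅ (_ ◅ P) Q = cong suc (len-◅◅ P Q)

  ◅◅-identityʳ : (P : Path u v) → P ◅◅ ε ≡ P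
  ◅◅-identityʳ ε       = refl
  ◅◅-identityʳ (a ◅ P) = cong (a ◅_) (◅◅-identityʳ P)

  ∈-extensions⁺ : (P : Path u v) (e : ArcBetween v w) → (w , P ◅◅ (e ◅ ε)) ∈ extensions P
  ∈-extensions⁺ {u} P (a , refl , refl) =
    Any.mapMaybe⁺ (extendBy P) (allFin #arcs) (Any.map⁺ (lose (∈-allFin a) extendBy-tail))
    where
    extendBy-tail : Maybe.Any ((head a , P ◅◅ ((a , refl , refl) ◅ ε)) ≡_) (extendBy P a)
    extendBy-tail with tail a Fin.≟ tail a
    ... | yes refl = Maybe.just refl
    ... | no  ≢    = contradiction refl ≢

  ∈-extensions⁻ : (P : Path u v) {R : PathFrom u} → R ∈ extensions P →
    ∃[ w ] ∃ λ (e : ArcBetween v w) → R ≡ (w , P ◅◅ (e ◅ ε))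
  ∈-extensions⁻ {u} {v} P =
    All.lookup (All.mapMaybe⁺ (All.map⁺ (All.universal extendBy-sound (allFin #arcs))))
    where
    extendBy-sound : ∀ a → Maybe.All
      (λ R → ∃[ w ] ∃ λ (e : ArcBetween v w) → R ≡ (w , P ◅◅ (e ◅ ε))) (extendBy P a)
    extendBy-sound a with tail a Fin.≟ v
    ... | yes _ = Maybe.just (_ , _ , refl)
    ... | no  _ = Maybe.nothing

  -- The finite universe in which paths are counted, both for termination and for the descent to a
  -- non-dominated path.
  pathsUpTo : ℕ → ∀ u → List (PathFrom u)
  startingWith : ℕ → ∀ u → Arc → List (PathFrom u)

  pathsUpTo zero    u = [ u , ε ]
  pathsUpTo (suc n) u = (u , ε) ∷ concatMap (startingWith n u) (allFin #arcs)

  startingWith n u a with tail a Fin.≟ u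
  ... | yes tail≡u = map (λ (w , P) → w , (a , tail≡u , refl) ◅ P) (pathsUpTo n (head a))
  ... | no  _      = []

  ∈-pathsUpTo : ∀ {n} (P : Path u v) → len P ℕ.≤ n → (v , P) ∈ pathsUpTo n u
  ∈-startingWith : ∀ {n} a (P : Path (head a) v) → len P ℕ.≤ n →
    (v , (a , refl , refl) ◅ P) ∈ startingWith n (tail a) a

  ∈-pathsUpTo {n = zero}  ε _ = here refl
  ∈-pathsUpTo {n = suc n} ε _ = here refl
  ∈-pathsUpTo ((a , refl , refl) ◅ P) (s≤s |P|≤n) =
    there (∈-concatMap⁺ _ (lose (∈-allFin a) (∈-startingWith a P |P|≤n)))

  ∈-startingWith a P |P|≤n with tail a Fin.≟ tail a
  ... | yes refl = ∈-map⁺ _ (∈-pathsUpTo P |P|≤n)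
  ... | no  ≢    = contradiction refl ≢

  len-cut : (P : Path u v) (e : ArcBetween v w) (C : Path w v) {w′ : Vertex} (Q : Path v w′) →
    len (P ◅◅ Q) ℕ.< len (P ◅◅ (e ◅ (C ◅◅ Q)))
  len-cut P e C Q rewrite len-◅◅ P Q | len-◅◅ P (e ◅ (C ◅◅ Q)) | len-◅◅ C Q =
    ℕ.+-monoʳ-< (len P) (s≤s (ℕ.m≤n+m (len Q) (len C)))

  -- The cycle is split as `e ◅ C`, which makes it nonempty by construction.
  data HasCycle {u v} : Path u v → Set where
    cycle : (P : Path u w) {w′ : Vertex} (e : ArcBetween w w′) (C : Path w′ w) (Q : Path w v) →
      HasCycle (P ◅◅ (e ◅ (C ◅◅ Q)))

  HasCycle-◅ : (e : ArcBetween u v) {P : Path v w} → HasCycle P → HasCycle (e ◅ P)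
  HasCycle-◅ e (cycle P f C Q) = cycle (e ◅ P) f C Q

  vertexAt : (P : Path u v) → Fin (suc (len P)) → Vertex
  vertexAt {u} _       zero    = u
  vertexAt     (_ ◅ P) (suc i) = vertexAt P i

  cutAt : (P : Path u v) (i : Fin (suc (len P))) →
    ∃ λ (Q : Path u (vertexAt P i)) → ∃ λ R → P ≡ Q ◅◅ R
  cutAt P       zero    = ε , P , refl
  cutAt (e ◅ P) (suc i) with Q , R , P≡QR ← cutAt P i = e ◅ Q , R , cong (e ◅_) P≡QR

  revisit⇒HasCycle : (P : Path u v) {i j : Fin (suc (len P))} → i Fin.< j →
    vertexAt P i ≡ vertexAt P j → HasCycle P
  revisit⇒HasCycle (e ◅ P) {zero} {suc j} _ eq
    -- Abstracting `vertexAt P j` to a variable together with the cut at `j` lets `eq` be matched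
    -- with `refl`, which closes the cycle `e ◅ Q`.
    with w ← vertexAt P j | Q , R , P≡QR ← cutAt P j
    rewrite P≡QR with refl ← eq = cycle ε e Q R
  revisit⇒HasCycle (e ◅ P) {suc i} {suc j} (s≤s i<j) eq =
    HasCycle-◅ e (revisit⇒HasCycle P i<j eq)

  -- A path has one more position than arcs, so `#vertices` arcs already force a repeated vertex.
  long⇒HasCycle : (P : Path u v) → #vertices ℕ.≤ len P → HasCycle P
  long⇒HasCycle P #V≤|P| with _ , _ , i<j , eq ← pigeonhole (s≤s #V≤|P|) (vertexAt P) =
    revisit⇒HasCycle P i<j eq

  -- Paths are built from the front, so passing an arc shifts the predicate by `e ◅_`. The empty
  -- prefix of a nonempty path counts, the whole path does not.
  StrictPrefixes : (∀ {w} → Pred (Path u w) ℓ) → Pred (Path u v) ℓ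
  StrictPrefixes B ε       = Unit.⊤
  StrictPrefixes B (e ◅ P) = B ε × StrictPrefixes (B ∘ (e ◅_)) P

  StrictPrefixes-map : {B : ∀ {w} → Pred (Path u w) ℓ} {B′ : ∀ {w} → Pred (Path u w) ℓ′} →
    (∀ {w} (Q : Path u w) → B Q → B′ Q) → (P : Path u v) → StrictPrefixes B P → StrictPrefixes B′ P
  StrictPrefixes-map f ε       _        = Unit.tt
  StrictPrefixes-map f (e ◅ P) (b , bs) = f ε b , StrictPrefixes-map (f ∘ (e ◅_)) P bs

  StrictPrefixes-∷ʳ : {B : ∀ {w} → Pred (Path u w) ℓ} (P : Path u v) (e : ArcBetween v w) →
    StrictPrefixes B P → B P → StrictPrefixes B (P ◅◅ (e ◅ ε))
  StrictPrefixes-∷ʳ ε       e _        b′ = b′ , Unit.tt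
  StrictPrefixes-∷ʳ (_ ◅ P) e (b , bs) b′ = b , StrictPrefixes-∷ʳ P e bs b′

  strictPrefix : {B : ∀ {w} → Pred (Path u w) ℓ} (P : Path u v) {v′ : Vertex}
    (e : ArcBetween v v′) (Q : Path v′ w) → StrictPrefixes B (P ◅◅ (e ◅ Q)) → B P
  strictPrefix ε       e Q (b , _)  = b
  strictPrefix (_ ◅ P) e Q (_ , bs) = strictPrefix P e Q bs

-- Consequences of excluded middle: minima and counting.

module Classical (em : ∀ {ℓ} → ExcludedMiddle ℓ) where

  ≤ℝ-totalOrder : TotalOrder _ _ _
  ≤ℝ-totalOrder = record
    { Carrier      = ℝ
    ; _≈_          = _≈ℝ_
    ; _≤_          = _≤ℝ_
    ; isTotalOrder = record
      { isPartialOrder = record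
        { isPreorder = record
          { isEquivalence = record
            { refl  = id , id
            ; sym   = λ (p , q) → q , p
            ; trans = λ (p , q) (p′ , q′) → p′ ∘ p , q ∘ q′
            }
          ; reflexive = proj₁
          ; trans     = λ p q → q ∘ p
          }
        ; antisym = _,_
        }
      ; total = ≤ℝ-total
      }
    }
    where
    ≤ℝ-total : ∀ x y → x ≤ℝ y ⊎ y ≤ℝ x
    ≤ℝ-total x y with em {P = x <ℝ y}
    ... | yes x<y = inj₁ (λ {q} → <ℝ⇒≤ℝ {x} {y} x<y {q})
    ... | no  x≮y = inj₂ (λ {q} → ≮ℝ⇒≥ℝ {x} {y} x≮y {q})

  minimum : (f : A → ℝ) {xs : List A} → xs ≢ [] →
    ∃[ x ] x ∈ xs × (∀ {y} → y ∈ xs → f x ≤ℝ f y)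
  minimum f {[]}     xs≢[] = contradiction refl xs≢[]
  minimum f {x ∷ xs} _     =
    argmin ≤ℝ-totalOrder f x xs ,
    [ here , there ]′ (argmin-sel ≤ℝ-totalOrder f x xs) ,
    (λ { (here refl) → f[argmin]≤f[⊤] ≤ℝ-totalOrder {f = f} x xs
       ; (there y∈)  → All.lookup (f[argmin]≤f[xs] ≤ℝ-totalOrder {f = f} x xs) y∈ })

  count : Pred A ℓ → List A → ℕ
  count P xs = length (filter (λ x → em {P = P x}) xs)

  -- Refiltering by `P?` changes nothing on the left, while on the list filtered by `Q?` it drops at
  -- least `x`.
  count-mono-< : {P : Pred A ℓ} {Q : Pred A ℓ′} → P ⊆ Q → ∀ {x xs} → x ∈ xs →
    Q x → ¬ P x → count P xs ℕ.< count Q xs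
  count-mono-< {P = P} {Q} P⊆Q {x} {xs} x∈xs q ¬p = begin-strict
    length (filter P? xs)               ≡⟨ cong length (filter-idem P? xs) ⟨
    length (filter P? (filter P? xs))   ≤⟨ length-mono-≤ (filter⁺ P? P? (λ { refl → id }) P?⊆Q?) ⟩
    length (filter P? (filter Q? xs))   <⟨ filter-notAll P? _ (lose (∈-filter⁺ Q? x∈xs q) ¬p) ⟩
    length (filter Q? xs)               ∎
    where
    open ℕ.≤-Reasoning
    P? = λ x → em {P = P x}
    Q? = λ x → em {P = Q x}
    P?⊆Q? = filter⁺ P? Q? (λ { refl → P⊆Q }) (⊆-refl {x = xs})

-- Resources of paths and removal of cycles.

module Resources {a ℓ₁ ℓ₂ : Level} (𝓡 : LatticeOrderedMonoid a ℓ₁ ℓ₂) (D : Digraph)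
  (x : Digraph.Arc D → LatticeOrderedMonoid.Carrier 𝓡) where

  open LatticeOrderedMonoid 𝓡
  open IsLattice isLattice public using (antisym; isPartialOrder; ≤-respˡ-≈)
    renaming (refl to ≤-refl; trans to ≤-trans; reflexive to ≤-reflexive; module Eq to ≈)
  open IsMonoid isMonoid using (assoc; identityˡ; identityʳ; ∙-congˡ)
  open Digraph D
  open Paths D
  open Resource 𝓡 D x

  private variable
    u v w : Vertex

  resource-◅◅ : (P : Path u v) (Q : Path v w) → resource (P ◅◅ Q) ≈ resource P ⊕ resource Q
  resource-◅◅ ε             Q = ≈.sym (identityˡ _)
  resource-◅◅ ((a , _) ◅ P) Q = ≈.trans (∙-congˡ (resource-◅◅ P Q)) (≈.sym (assoc _ _ _))

  resource-ε : (P : Path u v) → resource P ⊕ 0# ≈ resource P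
  resource-ε P = identityʳ _

  -- Needed when an extension of `P` takes over the first arc of a completion of `P`.
  ⊕-∷ʳ : (P : Path u v) (e : ArcBetween v w) {w′ : Vertex} (T : Path w w′) →
    resource (P ◅◅ (e ◅ ε)) ⊕ resource T ≈ resource P ⊕ resource (e ◅ T)
  ⊕-∷ʳ P e T = ≈.trans (≈.sym (resource-◅◅ (P ◅◅ (e ◅ ε)) T))
    (≈.trans (≈.reflexive (cong resource (◅◅-assoc P (e ◅ ε) T))) (resource-◅◅ P (e ◅ T)))

  module _ (cyc : ∀ v (C : Path v v) → IsCycle C → 0# ≤ resource C) where

    closed≥0 : (T : Path v v) → 0# ≤ resource T
    closed≥0 ε         = ≤-refl
    closed≥0 C@(_ ◅ _) = cyc _ C (λ ())

    ≤-◅◅-closed : (P : Path u v) (C : Path v v) → resource P ≤ resource (P ◅◅ C)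
    ≤-◅◅-closed P C = ≤-trans (≤-reflexive (≈.sym (identityʳ _)))
      (≤-trans (⊕-monoʳ-≤ _ (closed≥0 C)) (≤-reflexive (≈.sym (resource-◅◅ P C))))

    cut-≤ : (P : Path u v) (C : Path v v) (Q : Path v w) →
      resource (P ◅◅ Q) ≤ resource (P ◅◅ (C ◅◅ Q))
    cut-≤ P C Q =
      ≤-trans (≤-reflexive (resource-◅◅ P Q))
      (≤-trans (⊕-monoˡ-≤ _ (≤-◅◅-closed P C))
      (≤-reflexive (≈.trans (≈.sym (resource-◅◅ (P ◅◅ C) Q)) (≈.reflexive (cong resource (◅◅-assoc P C Q))))))

    -- Cycles are cut while the path has at least `#vertices` arcs; every cut removes at least one
    -- arc and, by `cut-≤`, does not raise the resource.
    shorten : (P : Path u v) → Acc ℕ._<_ (len P) →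
      ∃ λ (Q : Path u v) → len Q ℕ.≤ #vertices × resource Q ≤ resource P
    shorten P (acc rec) with #vertices ℕ.≤? len P
    ... | no  #V≰|P| = P , ℕ.<⇒≤ (ℕ.≰⇒> #V≰|P|) , ≤-refl
    ... | yes #V≤|P| with long⇒HasCycle P #V≤|P|
    ...   | cycle P₁ e C P₂
      with Q , short , Q≤ ← shorten (P₁ ◅◅ P₂) (rec (len-cut P₁ e C P₂)) =
      Q , short , ≤-trans Q≤ (cut-≤ P₁ (e ◅ C) P₂)

-- Feasibility, extended costs and non-dominated paths.

module Correctness (em : ∀ {ℓ} → ExcludedMiddle ℓ)
  {a ℓ₁ ℓ₂ : Level} (𝓡 : LatticeOrderedMonoid a ℓ₁ ℓ₂) (D : Digraph)
  (o d : Digraph.Vertex D) (x : Digraph.Arc D → LatticeOrderedMonoid.Carrier 𝓡)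
  (c : LatticeOrderedMonoid.Carrier 𝓡 → ℝ)
  (c-mono : Monotonic₁ (LatticeOrderedMonoid._≤_ 𝓡) _≤ℝ_ c)
  (ρ : LatticeOrderedMonoid.Carrier 𝓡 → Fin 2)
  (ρ-mono : Monotonic₁ (LatticeOrderedMonoid._≤_ 𝓡) Fin._≤_ ρ)
  (b : Digraph.Vertex D → LatticeOrderedMonoid.Carrier 𝓡)
  (b-bound : ∀ v (P : Digraph.Path D v d) →
    LatticeOrderedMonoid._≤_ 𝓡 (b v) (Resource.resource 𝓡 D x P))
  (cyc : ∀ v (C : Digraph.Path D v v) → Digraph.IsCycle D C →
    LatticeOrderedMonoid._≤_ 𝓡 (LatticeOrderedMonoid.0# 𝓡) (Resource.resource 𝓡 D x C))
  where

  open LatticeOrderedMonoid 𝓡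
  open Digraph D
  open Resource 𝓡 D x
  open Paths D
  open Classical em
  open Resources 𝓡 D x
  open Problem o d c ρ
  open LabelCorrecting em b

  private variable
    v w : Vertex
    m n : ℕ
    y z : Carrier
    s s′ : State
    α β γ : ℝ ⁺

  ρ-zero : y ≤ z → ρ z ≡ zero → ρ y ≡ zero
  ρ-zero {y} y≤z ρz≡0 with ρ y | ρ-mono y≤z
  ... | zero  | _ = refl
  ... | suc _ | ρy≤ρz rewrite ρz≡0 with () ← ρy≤ρz

  ≤∞-trans : α ≤∞ β → β ≤∞ γ → α ≤∞ γ
  ≤∞-trans = NonStrict⁺.≤⁺-trans _≤ℝ_ (λ p q → q ∘ p)

  ≤∞-refl : α ≤∞ α
  ≤∞-refl {fin _} = NonStrict⁺.[ id ]
  ≤∞-refl {⊤⁺}    = ⊤⁺ NonStrict⁺.≤⊤⁺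

  <∞⇒≤∞ : α <∞ β → α ≤∞ β
  <∞⇒≤∞ (Strict⁺.[_] {p} {q} lt) = NonStrict⁺.[ (λ {r} → <ℝ⇒≤ℝ {p} {q} lt {r}) ]
  <∞⇒≤∞ Strict⁺.[ _ ]<⊤⁺ = _ NonStrict⁺.≤⊤⁺

  ≮∞⇒≥∞ : ¬ α <∞ β → β ≤∞ α
  ≮∞⇒≥∞ {fin p} {fin q} ≮ = NonStrict⁺.[ (λ {r} → ≮ℝ⇒≥ℝ {p} {q} (≮ ∘ Strict⁺.[_]) {r}) ]
  ≮∞⇒≥∞ {fin p} {⊤⁺}    ≮ = contradiction Strict⁺.[ _ ]<⊤⁺ ≮
  ≮∞⇒≥∞ {⊤⁺}            ≮ = _ NonStrict⁺.≤⊤⁺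

  ≰∞⇒≥∞ : ¬ α ≤∞ β → β ≤∞ α
  ≰∞⇒≥∞ ≰ = ≮∞⇒≥∞ (≰ ∘ <∞⇒≤∞)

  -- The order on resources need not be well founded. The descent still stops: each strictly better
  -- path can be shortened into a finite list, and the number of listed paths strictly below the
  -- current one drops.
  nonDominatedBelow : (P : Path o d) → ∃ λ (Q : Path o d) → resource Q ≤ resource P × NonDominated Q
  nonDominatedBelow P = go P (<-wellFounded _)
    where
    strictlyBelow : Path o d → Pred (PathFrom o) _
    strictlyBelow P (v , Q) = ∃ λ (v≡d : v ≡ d) → resource (subst (Path o) v≡d Q) < resource P

    size : Path o d → ℕ
    size P = count (strictlyBelow P) (pathsUpTo #vertices o)

    go : ∀ P → Acc ℕ._<_ (size P) → ∃ λ (Q : Path o d) → resource Q ≤ resource P × NonDominated Q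
    go P (acc rec) with em {P = ∃ λ (Q : Path o d) → resource Q < resource P}
    ... | no  nd = P , ≤-refl , nd
    ... | yes (Q , Q<P)
      with R , short , R≤Q ← shorten cyc Q (<-wellFounded _)
      with R<P ← ToStrict.≤-<-trans _≈_ _≤_ ≤-trans antisym ≤-respˡ-≈ R≤Q Q<P
      -- `R` is counted for `P` but, by irreflexivity of `<`, not for itself.
      with S , S≤R , nd ← go R (rec (count-mono-<
             (λ { (refl , lt) → refl , ToStrict.<-trans _≈_ _≤_ isPartialOrder lt R<P })
             (∈-pathsUpTo R short) (refl , R<P) (λ { (refl , R<R) → proj₂ R<R ≈.refl }))) =
      S , ≤-trans S≤R (proj₁ R<P) , nd

  -- The covering invariant.

  Dominated : State → Pred (Path o v) _
  Dominated s Q = ∃[ R ] R ∈ M s _ × Dominates R Q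

  Settled : State → Pred Carrier _
  Settled s y = ρ y ≡ zero → c-UB s ≤∞ fin (c y)

  -- Stated for a resource `y` rather than a path, so that it passes to larger resources and applies
  -- to sums `resource R ⊕ resource T`.
  Covered : State → ℕ → Pred Carrier _
  Covered s n y = Settled s y ⊎
    (∃[ v ] ∃ λ (P : Path o v) → ∃ λ (T : Path v d) →
       (v , P) ∈ L s × len T ℕ.< n × resource P ⊕ resource T ≤ y)

  Settled-mono : ∀ s → y ≤ z → Settled s y → Settled s z
  Settled-mono s y≤z settled ρz≡0 = ≤∞-trans (settled (ρ-zero y≤z ρz≡0)) NonStrict⁺.[ c-mono y≤z ]

  Covered-mono : ∀ s → m ℕ.≤ n → y ≤ z → Covered s m y → Covered s n z
  Covered-mono s m≤n y≤z (inj₁ settled) = inj₁ (Settled-mono s y≤z settled)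
  Covered-mono s m≤n y≤z (inj₂ (v , P , T , P∈L , lt , le)) =
    inj₂ (v , P , T , P∈L , ℕ.<-≤-trans lt m≤n , ≤-trans le y≤z)

  -- M-covered bounds the completion by len T strictly: this strictness is what
  -- Covered-step recurses on.
  record Invariant (s : State) : Set (Level.suc 0ℓ ⊔ a ⊔ ℓ₂) where
    field
      prefixes : ∀ {P : Path o v} → (v , P) ∈ L s →
        StrictPrefixes (λ Q → Dominated s Q × ¬ HasCycle Q) P
      c-UB-attained : ∀ {γ} → c-UB s ≡ fin γ → ∃ λ (P : Path o d) → Feasible P × γ ≡ cost P
      M-covered : ∀ {R : Path o v} → R ∈ M s v → (T : Path v d) →
        Covered s (len T) (resource R ⊕ resource T)
      all-covered : (Q : Path o d) → Covered s (suc (len Q)) (resource Q)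

  open Invariant

  -- A path of `L` stays, has its completions covered anew, or is dominated by a path of `M`. Only
  -- the last case recurses: `M-covered` then settles the resource or supplies a strictly shorter
  -- completion, so `n` drops.
  Covered-step : ∀ s s′ → Invariant s → c-UB s′ ≤∞ c-UB s →
    (∀ {v} {P : Path o v} → (v , P) ∈ L s → (T : Path v d) →
       (v , P) ∈ L s′ ⊎ Covered s′ (suc (len T)) (resource P ⊕ resource T) ⊎ Dominated s P) →
    ∀ n → Covered s n y → Covered s′ n y
  Covered-step s s′ inv ub fate n (inj₁ settled) = inj₁ (λ ρy≡0 → ≤∞-trans ub (settled ρy≡0))
  Covered-step s s′ inv ub fate (suc n) (inj₂ (v , P , T , P∈L , lt@(s≤s |T|≤n) , le)) with fate P∈L T
  ... | inj₁ P∈L′            = inj₂ (v , P , T , P∈L′ , lt , le)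
  ... | inj₂ (inj₁ covered)  = Covered-mono s′ lt le covered
  ... | inj₂ (inj₂ (R , R∈M , R≤P)) = Covered-mono s′ (ℕ.n≤1+n n) ≤-refl
    (Covered-step s s′ inv ub fate n
      (Covered-mono s |T|≤n (≤-trans (⊕-monoˡ-≤ _ R≤P) le) (M-covered inv R∈M T)))

  ∈-update⁻ : ∀ {ℓ} (B : ∀ {w} → Pred (Path o w) ℓ) (N : ∀ w → List (Path o w)) {Ps : List (Path o v)} →
    (∀ {R} → R ∈ Ps → B R) → (∀ {w} {R : Path o w} → R ∈ N w → B R) →
    ∀ {w} {R : Path o w} → R ∈ (N [ v ≔ Ps ]) w → B R
  ∈-update⁻ {v} B N new old {w} R∈ with v Fin.≟ w
  ... | yes refl = new R∈
  ... | no  _    = old R∈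

  ∈-update-here : (N : ∀ w → List (Path o w)) {Ps : List (Path o v)} {R : Path o v} →
    R ∈ Ps → R ∈ (N [ v ≔ Ps ]) v
  ∈-update-here {v} N R∈ with v Fin.≟ v
  ... | yes refl = R∈
  ... | no  ≢    = contradiction refl ≢

  extended : State → Path o v → List (PathFrom o) → State
  extended {v} s P L′ = state
    (filter (λ Q → em {P = ¬ DominatedInM s P Q}) L′ ++ extensions P)
    (c-UB s)
    (M s [ v ≔ P ∷ filter (λ R → em {P = ¬ Dominates P R}) (M s v) ])

  module Extension (s : State) (P : Path o v) (L′ : List (PathFrom o)) where

    P∈M : P ∈ M (extended s P L′) v
    P∈M = ∈-update-here (M s) (here refl)

    -- Whatever leaves `M` is dominated by `P`, which takes its place by transitivity.
    stillDominated : (Q : Path o w) → Dominated s Q → Dominated (extended s P L′) Q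
    stillDominated {w} _ (R , R∈M , R≤Q) with v Fin.≟ w
    ... | no  _    = R , R∈M , R≤Q
    ... | yes refl with em {P = Dominates P R}
    ...   | yes P≤R = P , here refl , ≤-trans P≤R R≤Q
    ...   | no  P≰R = R , there (∈-filter⁺ _ R∈M P≰R) , R≤Q

    -- With no arc left, `P` ends at `d`, and a failed improvement means that `P` is infeasible or
    -- no cheaper than `c-UB`. Otherwise the first arc moves into an extension of `P` in `L`, which
    -- leaves a completion one arc shorter.
    suffixCovered : ¬ Improves s (v , P) → (T : Path v d) →
      Covered (extended s P L′) (len T) (resource P ⊕ resource T)
    suffixCovered ¬imp ε = inj₁ (Settled-mono s (≤-reflexive (≈.sym (resource-ε P)))
      (λ feas → ≮∞⇒≥∞ (λ lt → ¬imp (refl , feas , lt))))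
    suffixCovered ¬imp (e ◅ T) = inj₂ (_ , P ◅◅ (e ◅ ε) , T ,
      ∈-++⁺ʳ _ (∈-extensions⁺ P e) , ℕ.≤-refl , ≤-reflexive (⊕-∷ʳ P e T))

  -- If a cycle ends `P`, the prefix before it is dominated by a path of `M`, hence so is `P`,
  -- because the cycle does not lower the resource. A cycle ending earlier lies in a strict prefix,
  -- which the invariant makes acyclic.
  acyclic : Invariant s → {P : Path o v} → (v , P) ∈ L s → ¬ Dominated s P → ¬ HasCycle P
  acyclic inv P∈L nd (cycle P₁ e C ε)
    with (R , R∈M , R≤P₁) , _ ← strictPrefix P₁ e (C ◅◅ ε) (prefixes inv P∈L) =
    nd (R , R∈M , ≤-trans R≤P₁ (≤-◅◅-closed cyc P₁ (e ◅ (C ◅◅ ε))))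
  acyclic inv P∈L nd (cycle P₁ e C (f ◅ P₂)) =
    proj₂ (strictPrefix (P₁ ◅◅ (e ◅ C)) f P₂
      (subst (StrictPrefixes _) (sym (◅◅-assoc P₁ (e ◅ C) (f ◅ P₂))) (prefixes inv P∈L)))
      (subst (λ C → HasCycle (P₁ ◅◅ (e ◅ C))) (◅◅-identityʳ C) (cycle P₁ e C ε))

  -- Preservation of the invariant.

  initial-invariant : Invariant initial
  initial-invariant = record
    { prefixes      = λ { (here refl) → Unit.tt }
    ; c-UB-attained = λ ()
    ; M-covered     = λ ()
    ; all-covered   = λ Q → inj₂ (o , ε , Q , here refl , ℕ.≤-refl , ≤-reflexive (identityˡ _))
    }
    where open IsMonoid isMonoid using (identityˡ)

  process-invariant : Invariant s → ∀ {R} (R∈L : R ∈ L s) →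
    Process s R (L s ─ R∈L) s′ → Invariant s′
  process-invariant {s} inv R∈L (update {P = P} (refl , feas , lt)) = record
    { prefixes      = prefixes inv ∘ ∈-─⁻ R∈L
    ; c-UB-attained = λ { refl → P , feas , refl }
    ; M-covered     = λ R∈M T → step _ (M-covered inv R∈M T)
    ; all-covered   = λ Q → step _ (all-covered inv Q)
    }
    where
    s₁ : State
    s₁ = state (L s ─ R∈L) (fin (cost P)) (M s)

    fate : ∀ {v} {Q : Path o v} → (v , Q) ∈ L s → (T : Path v d) →
      (v , Q) ∈ L s₁ ⊎ Covered s₁ (suc (len T)) (resource Q ⊕ resource T) ⊎ Dominated s Q
    fate Q∈L T with ∈-─⁺ R∈L Q∈L
    ... | inj₂ Q∈L′ = inj₁ Q∈L′
    -- `P` is dropped unextended, but any completion of it is a closed walk at `d`, so the completed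
    -- path costs at least the new bound.
    ... | inj₁ refl = inj₂ (inj₁ (inj₁ (λ _ → NonStrict⁺.[ c-mono
      (≤-trans (≤-◅◅-closed cyc P T) (≤-reflexive (resource-◅◅ P T))) ])))

    step : ∀ n → Covered s n y → Covered s₁ n y
    step = Covered-step s s₁ inv (<∞⇒≤∞ lt) fate
  process-invariant {s} inv R∈L (discard {P = v , P} ¬imp ¬pass) = record
    { prefixes      = prefixes inv ∘ ∈-─⁻ R∈L
    ; c-UB-attained = c-UB-attained inv
    ; M-covered     = λ R∈M T → step _ (M-covered inv R∈M T)
    ; all-covered   = λ Q → step _ (all-covered inv Q)
    }
    where
    s₁ : State
    s₁ = state (L s ─ R∈L) (c-UB s) (M s)

    fate : ∀ {v} {Q : Path o v} → (v , Q) ∈ L s → (T : Path v d) →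
      (v , Q) ∈ L s₁ ⊎ Covered s₁ (suc (len T)) (resource Q ⊕ resource T) ⊎ Dominated s Q
    fate Q∈L T with ∈-─⁺ R∈L Q∈L
    ... | inj₂ Q∈L′ = inj₁ Q∈L′
    ... | inj₁ refl with em {P = Dominated s P}
    ...   | yes dom = inj₂ (inj₂ dom)
    -- `P` then failed the lower bound test: if `resource P ⊕ b v` is feasible, its cost is not
    -- below `c-UB`, and isotonicity passes this on to `resource P ⊕ resource T`.
    ...   | no  nd  = inj₂ (inj₁ (inj₁ (Settled-mono s (⊕-monoʳ-≤ _ (b-bound v T))
      (λ feas → ≰∞⇒≥∞ (λ le → ¬pass ((feas , le) , nd))))))

    step : ∀ n → Covered s n y → Covered s₁ n y
    step = Covered-step s s₁ inv ≤∞-refl fate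
  process-invariant {s} inv R∈L (extend {v} {P} ¬imp (_ , nd)) = record
    { prefixes      = prefixes′
    ; c-UB-attained = c-UB-attained inv
    ; M-covered     = λ R∈M → ∈-update⁻ {v = v}
        (λ {w} R → (T : Path w d) → Covered s₁ (len T) (resource R ⊕ resource T)) (M s)
        (λ { (here refl) → suffixCovered ¬imp
           ; (there R∈)  → λ T → step _ (M-covered inv (proj₁ (∈-filter⁻ _ R∈)) T) })
        (λ R∈ T → step _ (M-covered inv R∈ T)) R∈M
    ; all-covered   = λ Q → step _ (all-covered inv Q)
    }
    where
    open Extension s P (L s ─ R∈L)
    s₁ : State
    s₁ = extended s P (L s ─ R∈L)

    prefixes′ : ∀ {w} {Q : Path o w} → (w , Q) ∈ L s₁ →
      StrictPrefixes (λ R → Dominated s₁ R × ¬ HasCycle R) Q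
    prefixes′ {w} {Q} Q∈L₁ with ∈-++⁻ _ Q∈L₁
    ... | inj₁ Q∈ = StrictPrefixes-map (λ R (dom , ac) → stillDominated R dom , ac) Q
      (prefixes inv (∈-─⁻ R∈L (proj₁ (∈-filter⁻ _ Q∈))))
    -- The only new strict prefix is `P` itself, now in `M` and acyclic because it passed the
    -- dominance test.
    ... | inj₂ Q∈ with _ , e , refl ← ∈-extensions⁻ P Q∈ =
      StrictPrefixes-∷ʳ P e
        (StrictPrefixes-map (λ R (dom , ac) → stillDominated R dom , ac) P (prefixes inv R∈L))
        ((P , P∈M , ≤-refl) , acyclic inv R∈L nd)

    fate : ∀ {v} {Q : Path o v} → (v , Q) ∈ L s → (T : Path v d) →
      (v , Q) ∈ L s₁ ⊎ Covered s₁ (suc (len T)) (resource Q ⊕ resource T) ⊎ Dominated s Q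
    fate {Q = Q} Q∈L T with ∈-─⁺ R∈L Q∈L
    ... | inj₁ refl = inj₂ (inj₁ (Covered-mono s₁ (ℕ.n≤1+n _) ≤-refl (suffixCovered ¬imp T)))
    ... | inj₂ Q∈L′ with em {P = DominatedInM s P (_ , Q)}
    ...   | no  nd′ = inj₁ (∈-++⁺ˡ (∈-filter⁺ _ Q∈L′ nd′))
    -- A path deleted from `L` is dominated by `P`, so whatever covers `P` completed by `T` covers
    -- `Q` completed by `T`.
    ...   | yes (_ , refl , _ , P≤Q) = inj₂ (inj₁
      (Covered-mono s₁ (ℕ.n≤1+n _) (⊕-monoˡ-≤ _ P≤Q) (suffixCovered ¬imp T)))

    step : ∀ n → Covered s n y → Covered s₁ n y
    step = Covered-step s s₁ inv ≤∞-refl fate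

  iteration-invariant : Invariant s → Iteration s s′ → Invariant s′
  iteration-invariant inv (iterate P∈L _ process) = process-invariant inv P∈L process

  reachable-invariant : Star Iteration s s′ → Invariant s → Invariant s′
  reachable-invariant ε        inv = inv
  reachable-invariant (i ◅ is) inv = reachable-invariant is (iteration-invariant inv i)

  -- Termination.

  Undominated : State → Pred (PathFrom o) _
  Undominated s (v , Q) = ¬ Dominated s Q

  measure : State → ℕ × ℕ
  measure s = count (Undominated s) (pathsUpTo #vertices o) , length (L s)

  _≺_ : Rel (ℕ × ℕ) 0ℓ
  _≺_ = ×-Lex _≡_ ℕ._<_ ℕ._<_

  ≺-wellFounded : WellFounded _≺_
  ≺-wellFounded = ×-wellFounded <-wellFounded <-wellFounded

  -- `extend` may lengthen `L`, but it turns `P` from undominated into dominated, and acyclicity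
  -- makes `P` short enough to be counted. The other iterations leave `M` alone.
  measure-decreases : Invariant s → ∀ {R} (R∈L : R ∈ L s) →
    Process s R (L s ─ R∈L) s′ → measure s′ ≺ measure s
  measure-decreases inv R∈L (update _)    = inj₂ (refl , length-─ R∈L)
  measure-decreases inv R∈L (discard _ _) = inj₂ (refl , length-─ R∈L)
  measure-decreases {s} inv R∈L (extend {P = P} _ (_ , nd)) =
    inj₁ (count-mono-< (λ {(_ , Q)} nd′ dom → nd′ (stillDominated Q dom)) (∈-pathsUpTo P short) nd
      (λ nd′ → nd′ (P , P∈M , ≤-refl)))
    where
    open Extension s P (L s ─ R∈L)
    short : len P ℕ.≤ #vertices
    short with #vertices ℕ.≤? len P
    ... | no  #V≰|P| = ℕ.<⇒≤ (ℕ.≰⇒> #V≰|P|)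
    ... | yes #V≤|P| = contradiction (long⇒HasCycle P #V≤|P|) (acyclic inv R∈L nd)

  accessible : Invariant s → Acc _≺_ (measure s) → Acc (flip Iteration) s
  accessible inv (acc rec) = acc λ { (iterate P∈L _ process) →
    accessible (process-invariant inv P∈L process) (rec (measure-decreases inv P∈L process)) }

  progress : L s ≢ [] → ∃ (Iteration s)
  progress {s} L≢[] with P , P∈L , least ← minimum key L≢[] with em {P = Improves s P}
  ... | yes imp  = _ , iterate P∈L (λ {Q} → least {Q}) (update imp)
  ... | no  ¬imp with em {P = PassesTests s P}
  ...   | yes pass  = _ , iterate P∈L (λ {Q} → least {Q}) (extend ¬imp pass)
  ...   | no  ¬pass = _ , iterate P∈L (λ {Q} → least {Q}) (discard ¬imp ¬pass)

  terminates : Terminates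
  terminates = accessible initial-invariant (≺-wellFounded _) , λ _ → progress

  -- Optimality at the end of a run.

  c-UB-least : Reachable s → L s ≡ [] → (Q : Path o d) → Feasible Q → c-UB s ≤∞ fin (cost Q)
  c-UB-least run L≡[] Q feas with all-covered (reachable-invariant run initial-invariant) Q
  ... | inj₁ ub = ub feas
  ... | inj₂ (_ , _ , _ , P∈L , _) rewrite L≡[] with () ← P∈L

  -- The path attaining `c-UB` is optimal but may be dominated. A non-dominated path below it is
  -- feasible because `ρ` is isotone, and optimality forces its cost to be the same.
  finite⇒optimal : Reachable s → L s ≡ [] → ∀ γ → c-UB s ≡ fin γ →
    ∃[ P ] Optimal P × NonDominated P × γ ≈ℝ cost P
  finite⇒optimal {s} run L≡[] γ ub≡γ
    with P , feas , refl ← c-UB-attained (reachable-invariant run initial-invariant) ub≡γ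
    with Q , Q≤P , nd ← nonDominatedBelow P =
    Q , (feasQ , λ R feasR {q} q∈ → minimal R feasR (c-mono Q≤P q∈)) , nd , minimal Q feasQ , c-mono Q≤P
    where
    minimal : ∀ R → Feasible R → cost P ≤ℝ cost R
    minimal R feasR with c-UB-least run L≡[] R feasR
    ... | le rewrite ub≡γ with NonStrict⁺.[ le′ ] ← le = le′
    feasQ : Feasible Q
    feasQ = ρ-zero Q≤P feas

  infinite⇒infeasible : Reachable s → L s ≡ [] → c-UB s ≡ ⊤⁺ → ¬ ∃ λ (P : Path o d) → Feasible P
  infinite⇒infeasible run L≡[] ub≡⊤ (P , feas) with c-UB-least run L≡[] P feas
  ... | le rewrite ub≡⊤ with () ← le

theorem5 :
  (em : ∀ {ℓ} → ExcludedMiddle ℓ) →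
  ∀ {a ℓ₁ ℓ₂ p : Level} (𝓡 : LatticeOrderedMonoid a ℓ₁ ℓ₂) →
  let open LatticeOrderedMonoid 𝓡 in
  ConditionallyComplete p →
  (D : Digraph) →
  let open Digraph D in
  (o d : Vertex) (x : Arc → Carrier) →
  let open Resource 𝓡 D x in
  (c : Carrier → ℝ) → Monotonic₁ _≤_ _≤ℝ_ c →
  (ρ : Carrier → Fin 2) → Monotonic₁ _≤_ _≤₀₁_ ρ →
  (b : Vertex → Carrier) →
  (∀ v (P : Path v d) → b v ≤ resource P) →
  (∀ v (C : Path v v) → IsCycle C → 0# ≤ resource C) →
  let open Problem o d c ρ
      open LabelCorrecting em b
  in
  Terminates ×
  (∀ s → Reachable s → L s ≡ [] →
    (∀ γ → c-UB s ≡ fin γ →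
      ∃[ P ] Optimal P × NonDominated P × γ ≈ℝ cost P) ×
    (c-UB s ≡ ⊤⁺ → ¬ ∃ λ (P : Path o d) → Feasible P))
theorem5 em 𝓡 _ D o d x c c-mono ρ ρ-mono b b-bound cyc =
  terminates , λ _ run L≡[] → finite⇒optimal run L≡[] , infinite⇒infeasible run L≡[]
  where open Correctness em 𝓡 D o d x c c-mono ρ ρ-mono b b-bound cyc
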